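{- Let $G=(V,E)$ be a complete bipartite graph $K_{r,s}$ ($r,s\ge1$), let $\emptyset\ne V_c\subsetneq V$, and let $g:V_c\to\{0,1\}$ be such that no two adjacent vertices of $V_c$ have the same value under $g$. Let $f$ be a maximum contrast greyscale for the $\{0,1\}$-restricted maximum contrast problem on $G$ with initial colouring $g$. Then its contrast vector $\mathcal C_f$ (the maximum contrast vector for the problem) has either all components equal to $1$ or else all components equal to $\frac12$.
   Context: Graphs are finite, undirected and simple. A greyscale of $G=(V,E)$ is a map $f:V\to[0,1]$ with $0,1\in \mathrm{Im}(f)$. For $e=\{u,v\}\in E$ put $\widehat f(e)=|f(u)-f(v)|$. The contrast vector $\mathcal C_f$ is the vector of all values $\widehat f(e)$, $e\in E$, listed in ascending order; contrast vectors are compared lexicographically. A greyscale $f$ is compatible with $g$ if $f(u)=g(u)$ for all $u\in V_c$. A maximum contrast greyscale for the $\{0,1\}$-restricted maximum contrast problem ($\{0,1\}$-RMACG) with data $(G,V_c,g)$ is a greyscale compatible with $g$ whose contrast vector is the lexicographic maximum among all greyscales of $G$ compatible with $g$. -}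

module Defs where

open import Algebra.Bundles using (CommutativeRing)
import Algebra.Construct.NaturalChoice.Max as Max
import Algebra.Properties.Ring as RingProperties
open import Data.Bool.Base using (Bool; true; false)
import Data.Bool.Properties as Bool
open import Data.Fin.Base using (Fin; zero; suc; splitAt)
open import Data.Fin.Properties using (_<?_)
open import Data.Fin.Subset using (Subset; _∈_)
open import Data.List.Base
  using (List; map; filter; allFin; cartesianProduct)
open import Data.List.Relation.Binary.Lex.NonStrict using (Lex-≤)
import Data.List.Sort as Sort
open import Data.Nat.Base using (ℕ; _+_)
open import Data.Product.Base using (∃; _×_; _,_; proj₁)
open import Data.Sum.Base using ([_,_]′; inj₁; inj₂)
open import Function.Base using (const)
open import Function.Bundles using (_↔_; _⇔_; module Inverse)
open import Level using (0ℓ)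
open import Relation.Binary.Bundles using (DecTotalOrder)
open import Relation.Binary.Core using (Rel)
open import Relation.Binary.Definitions
  using (Decidable; Symmetric; Irreflexive)
open import Relation.Binary.PropositionalEquality.Core
  using (_≡_; _≢_; refl; ≢-sym)
open import Relation.Binary.Structures using (IsDecTotalOrder)
open import Relation.Nullary.Decidable using (¬?; _×-dec_)
open import Relation.Nullary.Negation using (¬_)
open import Relation.Unary using (Pred)

-- The real numbers, axiomatised as a Dedekind-complete ordered field.
-- The order is decidable, as it is classically.  A set of reals is a
-- predicate on the carrier, which need not respect _≈_.

record RealNumbers : Set₁ where
  infix 4 _≤_
  field
    commutativeRing : CommutativeRing 0ℓ 0ℓ

  open CommutativeRing commutativeRing public
    hiding (_≉_)
    renaming (_+_ to _+ᴿ_; refl to ≈-refl; sym to ≈-sym; trans to ≈-trans)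

  field
    0≉1             : ¬ (0# ≈ 1#)
    inverse         : ∀ x → ¬ (x ≈ 0#) → ∃ λ y → x * y ≈ 1#
    _≤_             : Rel Carrier 0ℓ
    isDecTotalOrder : IsDecTotalOrder _≈_ _≤_
    +-monoˡ-≤       : ∀ {x y} z → x ≤ y → x +ᴿ z ≤ y +ᴿ z
    *-nonNegative   : ∀ {x y} → 0# ≤ x → 0# ≤ y → 0# ≤ x * y

  UpperBound : Pred Carrier 0ℓ → Pred Carrier 0ℓ
  UpperBound P b = ∀ x → P x → x ≤ b

  field
    supremum : (P : Pred Carrier 0ℓ) → ∃ P → ∃ (UpperBound P) →
               ∃ λ s → UpperBound P s × (∀ b → UpperBound P b → s ≤ b)

  decTotalOrder : DecTotalOrder 0ℓ 0ℓ 0ℓ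
  decTotalOrder = record { isDecTotalOrder = isDecTotalOrder }

  private
    module O = DecTotalOrder decTotalOrder

  ∣_∣ : Carrier → Carrier
  ∣ x ∣ = x ⊔ (- x)
    where open Max O.totalOrder using (_⊔_)

  0≤1 : 0# ≤ 1#
  0≤1 with O.total 0# 1#
  ... | inj₁ p = p
  ... | inj₂ p = O.≤-respʳ-≈ [-1]²≈1 (*-nonNegative 0≤-1 0≤-1)
    where
    open RingProperties ring using (-1*x≈-x; -‿involutive)
    0≤-1 : 0# ≤ - 1#
    0≤-1 = O.≤-respˡ-≈ (-‿inverseʳ 1#)
             (O.≤-respʳ-≈ (+-identityˡ (- 1#)) (+-monoˡ-≤ (- 1#) p))
    [-1]²≈1 : - 1# * - 1# ≈ 1#
    [-1]²≈1 = ≈-trans (-1*x≈-x (- 1#)) (-‿involutive 1#)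

  2≉0 : ¬ (1# +ᴿ 1# ≈ 0#)
  2≉0 2≈0 = 0≉1 (O.antisym 0≤1 1≤0)
    where
    1≤0 : 1# ≤ 0#
    1≤0 = O.≤-respʳ-≈ 2≈0
            (O.≤-respˡ-≈ (+-identityˡ 1#) (+-monoˡ-≤ 1# 0≤1))

  ½ : Carrier
  ½ = proj₁ (inverse (1# +ᴿ 1#) 2≉0)

record Graph (n : ℕ) : Set₁ where
  field
    Adj        : Rel (Fin n) 0ℓ
    adj?       : Decidable Adj
    adj-sym    : Symmetric Adj
    adj-irrefl : Irreflexive _≡_ Adj

  -- Each edge {u , v} occurs exactly once, as the pair with u < v.
  edges : List (Fin n × Fin n)
  edges = filter (λ (u , v) → (u <? v) ×-dec adj? u v)
                 (cartesianProduct (allFin n) (allFin n))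

infix 4 _≅_

record _≅_ {m n : ℕ} (G : Graph m) (H : Graph n) : Set where
  field
    bijection : Fin m ↔ Fin n
    adj⇔adj   : ∀ u v →
      Graph.Adj G u v ⇔
      Graph.Adj H (Inverse.to bijection u) (Inverse.to bijection v)

-- The first r vertices form one side, the remaining s the other.
K : (r s : ℕ) → Graph (r + s)
K r s = record
  { Adj        = λ u v → side u ≢ side v
  ; adj?       = λ u v → ¬? (side u Bool.≟ side v)
  ; adj-sym    = ≢-sym
  ; adj-irrefl = λ { refl u≢u → u≢u refl }
  }
  where
  side : Fin (r + s) → Bool
  side u = [ const true , const false ]′ (splitAt r u)

-- A map g : V_c → {0,1}.
Colouring : {n : ℕ} → Subset n → Set
Colouring {n} Vc = (v : Fin n) → v ∈ Vc → Fin 2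

NoMonochromaticEdge : {n : ℕ} → Graph n → (Vc : Subset n) → Colouring Vc → Set
NoMonochromaticEdge G Vc g =
  ∀ u v (u∈ : u ∈ Vc) (v∈ : v ∈ Vc) → Graph.Adj G u v → g u u∈ ≢ g v v∈

module Greyscales (ℝ : RealNumbers) where
  open RealNumbers ℝ
  open Sort decTotalOrder using (sort)

  infix 4 _≤ₗₑₓ_

  _≤ₗₑₓ_ : Rel (List Carrier) 0ℓ
  _≤ₗₑₓ_ = Lex-≤ _≈_ _≤_

  record IsGreyscale {n : ℕ} (f : Fin n → Carrier) : Set where
    field
      0≤f : ∀ v → 0# ≤ f v
      f≤1 : ∀ v → f v ≤ 1#
      0∈f : ∃ λ v → f v ≈ 0#
      1∈f : ∃ λ v → f v ≈ 1#

  contrastVector : {n : ℕ} → Graph n → (Fin n → Carrier) → List Carrier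
  contrastVector G f = sort (map (λ (u , v) → ∣ f u - f v ∣) (Graph.edges G))

  ⟦_⟧ : Fin 2 → Carrier
  ⟦ zero ⟧     = 0#
  ⟦ suc zero ⟧ = 1#

  Compatible : {n : ℕ} (Vc : Subset n) → Colouring Vc → (Fin n → Carrier) → Set
  Compatible Vc g f = ∀ v (v∈ : v ∈ Vc) → f v ≈ ⟦ g v v∈ ⟧

  record IsMaximumContrast {n : ℕ} (G : Graph n) (Vc : Subset n)
                           (g : Colouring Vc) (f : Fin n → Carrier) : Set where
    field
      isGreyscale : IsGreyscale f
      compatible  : Compatible Vc g f
      maximal     : ∀ h → IsGreyscale h → Compatible Vc g h →
                    contrastVector G h ≤ₗₑₓ contrastVector G f

{-# OPTIONS --safe #-}

-- Compare f with a compatible greyscale h of constant contrast c: since the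
-- contrast vectors have the same length and that of f is sorted,
-- lexicographic maximality of f forces every contrast of f to be at least c.
-- If g extends to a proper 2-colouring with values 0 and 1, take that colouring for h,
-- so c = 1.  Otherwise some p and q in V_c on a common side have the values 0 and 1,
-- and V_c lies inside that side; then h is 1/2 on the other side, so c = 1/2.
-- A value at distance at least 1/2 from both 0 and 1 is 1/2, so f is also 1/2 on the
-- other side, and then no contrast of f exceeds 1/2.
module Submission where

open import Defs
import Algebra.Construct.NaturalChoice.Max as Max
import Algebra.Properties.AbelianGroup as AbelianGroupProperties
import Algebra.Properties.Group as GroupProperties
open import Data.Bool.Base using (Bool; true; false; not; _xor_; if_then_else_)
import Data.Bool.Properties as Bool
open import Data.Fin.Base using (Fin; zero; suc; _<_; splitAt; _↑ʳ_)
open import Data.Fin.Properties using (_<?_; <-cmp; all?; ¬∀⟶∃¬; splitAt-↑ʳ)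
open import Data.Fin.Subset using (Subset; Nonempty; _⊂_; ⊤; _∈_)
open import Data.Fin.Subset.Properties using (_∈?_)
open import Data.List.Base using (List; []; _∷_; map; allFin; cartesianProduct; length)
open import Data.List.Membership.Propositional.Properties
  using (∈-filter⁺; ∈-cartesianProduct⁺; ∈-allFin)
open import Data.List.Properties using (length-map)
open import Data.List.Relation.Binary.Lex.NonStrict using (this; next)
open import Data.List.Relation.Binary.Permutation.Propositional using (↭-sym)
open import Data.List.Relation.Binary.Permutation.Propositional.Properties
  using (All-resp-↭; ↭-length)
open import Data.List.Relation.Unary.All as All using (All; []; _∷_)
open import Data.List.Relation.Unary.All.Properties using (map⁺; map⁻; all-filter)
open import Data.List.Relation.Unary.AllPairs using (_∷_)
import Data.List.Relation.Unary.Sorted.TotalOrder as Sorted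
open import Data.List.Relation.Unary.Sorted.TotalOrder.Properties using (Sorted⇒AllPairs)
import Data.List.Sort as Sort
open import Data.Nat.Base using (ℕ; suc; _+_; _≤_; s≤s)
open import Data.Product.Base using (∃; _×_; _,_; proj₁; proj₂)
open import Data.Sum.Base using (_⊎_; inj₁; inj₂; [_,_]′)
open import Function.Base using (const; _∘_)
open import Function.Bundles using (Equivalence; Inverse)
open import Relation.Binary.Bundles using (DecTotalOrder)
open import Relation.Binary.Definitions using (tri<; tri≈; tri>)
open import Relation.Binary.PropositionalEquality
  using (_≡_; _≢_; refl; sym; trans; cong)
import Relation.Binary.Reasoning.PartialOrder as PosetReasoning
open import Relation.Nullary.Decidable
  using (Dec; yes; no; does; _×-dec_; _→-dec_; decidable-stable)
open import Relation.Nullary.Negation using (¬_; contradiction)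

-- Complete bipartite graphs as graphs with two inhabited sides.

record CompleteBipartition {n : ℕ} (G : Graph n) : Set where
  open Graph G
  field
    side      : Fin n → Bool
    adj⇒≢     : ∀ {u v} → Adj u v → side u ≢ side v
    ≢⇒adj     : ∀ {u v} → side u ≢ side v → Adj u v
    inhabited : ∀ b → ∃ λ v → side v ≡ b

-- Sides are pulled back along the isomorphism, and positive `r` and `s` supply a vertex on each.
-- This frees the main argument from `K r s`.
completeBipartition : ∀ {r s n} {G : Graph n} → 1 ≤ r → 1 ≤ s →
                      G ≅ K r s → CompleteBipartition G
completeBipartition {r = suc r} {s = suc s} (s≤s _) (s≤s _) G≅K = record
  { side      = sideK ∘ to
  ; adj⇒≢     = Equivalence.to (adj⇔adj _ _)
  ; ≢⇒adj     = Equivalence.from (adj⇔adj _ _)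
  ; inhabited = λ b → from (vertex b) ,
                      trans (cong sideK (strictlyInverseˡ (vertex b))) (sideK-vertex b)
  }
  where
  open _≅_ G≅K
  open Inverse bijection using (to; from; strictlyInverseˡ)

  -- A copy of the function local to K, to which adjacency in K unfolds.
  sideK : Fin (suc r + suc s) → Bool
  sideK u = [ const true , const false ]′ (splitAt (suc r) u)

  vertex : Bool → Fin (suc r + suc s)
  vertex true  = zero
  vertex false = suc r ↑ʳ zero

  sideK-vertex : ∀ b → sideK (vertex b) ≡ b
  sideK-vertex true  = refl
  sideK-vertex false =
    cong [ const true , const false ]′ (splitAt-↑ʳ (suc r) (suc s) zero)

-- Distances and one half in the ordered field.

module Distance (ℝ : RealNumbers) where
  open RealNumbers ℝ renaming (_≤_ to infix 4 _≤ᴿ_)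
  private
    module O = DecTotalOrder decTotalOrder
  open Max O.totalOrder using (_⊔_; ⊔-cong; ⊔-comm; x≤y⇒x⊔y≈y)
  open GroupProperties +-group using (\\-leftDividesˡ; //-rightDividesʳ; ε⁻¹≈ε)
  open AbelianGroupProperties +-abelianGroup using (⁻¹-anti-homo‿-; xyx⁻¹≈y)
  open PosetReasoning O.poset

  neg-anti-≤ : ∀ {x y} → x ≤ᴿ y → - y ≤ᴿ - x
  neg-anti-≤ {x} {y} x≤y = begin
    - y                 ≈⟨ \\-leftDividesˡ x (- y) ⟨
    x +ᴿ (- x +ᴿ - y)   ≤⟨ +-monoˡ-≤ _ x≤y ⟩
    y +ᴿ (- x +ᴿ - y)   ≈⟨ +-congˡ (+-comm (- x) (- y)) ⟩
    y +ᴿ (- y +ᴿ - x)   ≈⟨ \\-leftDividesˡ y (- x) ⟩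
    - x                 ∎

  sub-mono-≤ : ∀ {w x y z} → w ≤ᴿ x → z ≤ᴿ y → w - y ≤ᴿ x - z
  sub-mono-≤ {w} {x} {y} {z} w≤x z≤y = begin
    w - y     ≤⟨ +-monoˡ-≤ (- y) w≤x ⟩
    x - y     ≈⟨ +-comm x (- y) ⟩
    - y +ᴿ x  ≤⟨ +-monoˡ-≤ x (neg-anti-≤ z≤y) ⟩
    - z +ᴿ x  ≈⟨ +-comm (- z) x ⟩
    x - z     ∎

  sub-zero : ∀ x → x - 0# ≈ x
  sub-zero x = ≈-trans (+-congˡ ε⁻¹≈ε) (+-identityʳ x)

  dist : Carrier → Carrier → Carrier
  dist x y = ∣ x - y ∣

  dist-cong : ∀ {w x y z} → w ≈ x → y ≈ z → dist w y ≈ dist x z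
  dist-cong w≈x y≈z = ⊔-cong (w-y≈x-z) (-‿cong w-y≈x-z)
    where w-y≈x-z = +-cong w≈x (-‿cong y≈z)

  dist-sym : ∀ x y → dist x y ≈ dist y x
  dist-sym x y = begin-equality
    (x - y) ⊔ - (x - y)      ≈⟨ ⊔-comm _ _ ⟩
    - (x - y) ⊔ (x - y)      ≈⟨ ⊔-cong (⁻¹-anti-homo‿- x y) (≈-sym (⁻¹-anti-homo‿- y x)) ⟩
    (y - x) ⊔ - (y - x)      ∎

  x≤y⇒dist≈y-x : ∀ {x y} → x ≤ᴿ y → dist x y ≈ y - x
  x≤y⇒dist≈y-x {x} {y} x≤y = ≈-trans (x≤y⇒x⊔y≈y x-y≤-[x-y]) (⁻¹-anti-homo‿- x y)
    where
    x-y≤-[x-y] : x - y ≤ᴿ - (x - y)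
    x-y≤-[x-y] = begin
      x - y      ≤⟨ +-monoˡ-≤ (- y) x≤y ⟩
      y - y      ≈⟨ -‿inverseʳ y ⟩
      0#         ≈⟨ -‿inverseʳ x ⟨
      x - x      ≤⟨ +-monoˡ-≤ (- x) x≤y ⟩
      y - x      ≈⟨ ⁻¹-anti-homo‿- x y ⟨
      - (x - y)  ∎

  x≥y⇒dist≈x-y : ∀ {x y} → y ≤ᴿ x → dist x y ≈ x - y
  x≥y⇒dist≈x-y y≤x = ≈-trans (dist-sym _ _) (x≤y⇒dist≈y-x y≤x)

  dist-zeroʳ : ∀ {x} → 0# ≤ᴿ x → dist x 0# ≈ x
  dist-zeroʳ 0≤x = ≈-trans (x≥y⇒dist≈x-y 0≤x) (sub-zero _)

  dist-one-zero : dist 1# 0# ≈ 1#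
  dist-one-zero = dist-zeroʳ 0≤1

  dist≤1 : ∀ {x y} → 0# ≤ᴿ x → x ≤ᴿ 1# → 0# ≤ᴿ y → y ≤ᴿ 1# → dist x y ≤ᴿ 1#
  dist≤1 {x} {y} 0≤x x≤1 0≤y y≤1 with O.total x y
  ... | inj₁ x≤y = begin
    dist x y  ≈⟨ x≤y⇒dist≈y-x x≤y ⟩
    y - x     ≤⟨ sub-mono-≤ y≤1 0≤x ⟩
    1# - 0#   ≈⟨ sub-zero 1# ⟩
    1#        ∎
  ... | inj₂ y≤x = begin
    dist x y  ≈⟨ x≥y⇒dist≈x-y y≤x ⟩
    x - y     ≤⟨ sub-mono-≤ x≤1 0≤y ⟩
    1# - 0#   ≈⟨ sub-zero 1# ⟩
    1#        ∎

  -- All later facts about `½` derive from this identity.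
  ½+½≈1 : ½ +ᴿ ½ ≈ 1#
  ½+½≈1 = begin-equality
    ½ +ᴿ ½                ≈⟨ +-cong (*-identityˡ ½) (*-identityˡ ½) ⟨
    1# * ½ +ᴿ 1# * ½      ≈⟨ distribʳ ½ 1# 1# ⟨
    (1# +ᴿ 1#) * ½        ≈⟨ proj₂ (inverse (1# +ᴿ 1#) 2≉0) ⟩
    1#                    ∎

  1-½≈½ : 1# - ½ ≈ ½
  1-½≈½ = ≈-trans (+-congʳ (≈-sym ½+½≈1)) (//-rightDividesʳ ½ ½)

  0≤½ : 0# ≤ᴿ ½
  0≤½ with O.total 0# ½
  ... | inj₁ 0≤½ = 0≤½
  ... | inj₂ ½≤0 = contradiction (O.antisym 0≤1 1≤0) 0≉1
    where
    1≤0 : 1# ≤ᴿ 0#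
    1≤0 = begin
      1#        ≈⟨ ½+½≈1 ⟨
      ½ +ᴿ ½    ≤⟨ +-monoˡ-≤ ½ ½≤0 ⟩
      0# +ᴿ ½   ≈⟨ +-identityˡ ½ ⟩
      ½         ≤⟨ ½≤0 ⟩
      0#        ∎

  ½≤1 : ½ ≤ᴿ 1#
  ½≤1 = begin
    ½         ≈⟨ 1-½≈½ ⟨
    1# - ½    ≤⟨ sub-mono-≤ O.refl 0≤½ ⟩
    1# - 0#   ≈⟨ sub-zero 1# ⟩
    1#        ∎

  dist-½≤½ : ∀ {x} → 0# ≤ᴿ x → x ≤ᴿ 1# → dist x ½ ≤ᴿ ½
  dist-½≤½ {x} 0≤x x≤1 with O.total x ½
  ... | inj₁ x≤½ = begin
    dist x ½  ≈⟨ x≤y⇒dist≈y-x x≤½ ⟩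
    ½ - x     ≤⟨ sub-mono-≤ O.refl 0≤x ⟩
    ½ - 0#    ≈⟨ sub-zero ½ ⟩
    ½         ∎
  ... | inj₂ ½≤x = begin
    dist x ½  ≈⟨ x≥y⇒dist≈x-y ½≤x ⟩
    x - ½     ≤⟨ sub-mono-≤ x≤1 O.refl ⟩
    1# - ½    ≈⟨ 1-½≈½ ⟩
    ½         ∎

  -- The distances from `x` to 0 and 1 are `x` and 1 - `x`, so the bounds say `x` ≥ ½ and `x` ≤ 1 -
  -- ½ = ½.
  farFromEnds⇒≈½ : ∀ {x} → 0# ≤ᴿ x → x ≤ᴿ 1# →
                   ½ ≤ᴿ dist x 0# → ½ ≤ᴿ dist x 1# → x ≈ ½
  farFromEnds⇒≈½ {x} 0≤x x≤1 ½≤d₀ ½≤d₁ = O.antisym x≤½ (O.≤-respʳ-≈ (dist-zeroʳ 0≤x) ½≤d₀)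
    where
    x≤½ : x ≤ᴿ ½
    x≤½ = begin
      x               ≈⟨ xyx⁻¹≈y 1# x ⟨
      1# +ᴿ x - 1#    ≈⟨ +-assoc 1# x (- 1#) ⟩
      1# +ᴿ (x - 1#)  ≈⟨ +-congˡ (⁻¹-anti-homo‿- 1# x) ⟨
      1# - (1# - x)   ≤⟨ sub-mono-≤ O.refl (O.≤-respʳ-≈ (x≤y⇒dist≈y-x x≤1) ½≤d₁) ⟩
      1# - ½          ≈⟨ 1-½≈½ ⟩
      ½               ∎

  -- Booleans index the colours as well as the sides, so that a proper 2-colouring is `side` up to
  -- `xor` with a constant.
  bit : Bool → Carrier
  bit b = if b then 1# else 0#

  0≤bit : ∀ b → 0# ≤ᴿ bit b
  0≤bit true  = 0≤1
  0≤bit false = O.refl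

  bit≤1 : ∀ b → bit b ≤ᴿ 1#
  bit≤1 true  = O.refl
  bit≤1 false = 0≤1

  bit-injective : ∀ {a b} → bit a ≈ bit b → a ≡ b
  bit-injective {true}  {true}  _ = refl
  bit-injective {false} {false} _ = refl
  bit-injective {true}  {false} p = contradiction (≈-sym p) 0≉1
  bit-injective {false} {true}  p = contradiction p 0≉1

  dist-bit-≢ : ∀ {a b} → a ≢ b → dist (bit a) (bit b) ≈ 1#
  dist-bit-≢ {true}  {true}  a≢b = contradiction refl a≢b
  dist-bit-≢ {false} {false} a≢b = contradiction refl a≢b
  dist-bit-≢ {true}  {false} _   = dist-one-zero
  dist-bit-≢ {false} {true}  _   = ≈-trans (dist-sym 0# 1#) dist-one-zero

  dist-bit-½ : ∀ b → dist (bit b) ½ ≈ ½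
  dist-bit-½ true  = ≈-trans (x≥y⇒dist≈x-y ½≤1) 1-½≈½
  dist-bit-½ false = ≈-trans (dist-sym 0# ½) (dist-zeroʳ 0≤½)

-- Contrast vectors and comparison with a constant contrast.

module Contrast (ℝ : RealNumbers) {n : ℕ} (G : Graph n) where
  open RealNumbers ℝ renaming (_≤_ to infix 4 _≤ᴿ_)
  open Greyscales ℝ
  open Graph G
  open Distance ℝ
  private
    module O = DecTotalOrder decTotalOrder
  open Sort decTotalOrder using (sort-↭; sort-↗)
  open Sorted O.totalOrder using (Sorted)

  contrasts : (Fin n → Carrier) → List Carrier
  contrasts f = map (λ (u , v) → dist (f u) (f v)) edges

  contrastVector-All⁺ : ∀ {P : Carrier → Set} f → (∀ {u v} → Adj u v → P (dist (f u) (f v))) →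
                        All P (contrastVector G f)
  contrastVector-All⁺ f p =
    All-resp-↭ (↭-sym (sort-↭ (contrasts f)))
      (map⁺ (All.map (λ (_ , uv) → p uv)
        (all-filter (λ (u , v) → (u <? v) ×-dec adj? u v) (cartesianProduct (allFin n) (allFin n)))))

  -- Sorting only permutes the entries. Each edge is listed once, smaller endpoint first, and `dist`
  -- is symmetric only up to `≈`; for the opposite orientation `P` must therefore respect `≈`.
  contrastVector-All⁻ : ∀ {P : Carrier → Set} f → (∀ {x y} → x ≈ y → P x → P y) →
                        All P (contrastVector G f) →
                        ∀ {u v} → Adj u v → P (dist (f u) (f v))
  contrastVector-All⁻ {P} f resp all {u} {v} uv = go
    where
    onEdges : All (λ (u , v) → P (dist (f u) (f v))) edges
    onEdges = map⁻ (All-resp-↭ (sort-↭ (contrasts f)) all)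

    onEdge : ∀ {x y} → x < y → Adj x y → P (dist (f x) (f y))
    onEdge {x} {y} x<y xy = All.lookup onEdges
      (∈-filter⁺ (λ (u , v) → (u <? v) ×-dec adj? u v)
        (∈-cartesianProduct⁺ (∈-allFin x) (∈-allFin y)) (x<y , xy))

    go : P (dist (f u) (f v))
    go with <-cmp u v
    ... | tri< u<v _ _  = onEdge u<v uv
    ... | tri≈ _ u≡v _  = contradiction uv (adj-irrefl u≡v)
    ... | tri> _ _ v<u  = resp (dist-sym (f v) (f u)) (onEdge v<u (adj-sym uv))

  length-contrastVector : ∀ f h → length (contrastVector G f) ≡ length (contrastVector G h)
  length-contrastVector f h =
    trans (length-cv f) (sym (length-cv h))
    where
    length-cv : ∀ f → length (contrastVector G f) ≡ length edges
    length-cv f = trans (↭-length (sort-↭ (contrasts f))) (length-map _ edges)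

  -- The lexicographic order puts `c` below the head of `ys`, which is its least entry. Equal
  -- lengths rule out an empty `xs` with a nonempty `ys`.
  constant≤ₗₑₓsorted : ∀ {c xs ys} → length xs ≡ length ys → All (_≈ c) xs → Sorted ys →
                       xs ≤ₗₑₓ ys → All (c ≤ᴿ_) ys
  constant≤ₗₑₓsorted {xs = []}    {[]}    _ _         _  _    = []
  constant≤ₗₑₓsorted {c} {x ∷ xs} {y ∷ ys} _ (x≈c ∷ _) ys↗ xs≤ys
    with Sorted⇒AllPairs O.totalOrder ys↗
  ... | y≤ys ∷ _ = c≤y ∷ All.map (O.trans c≤y) y≤ys
    where
    head≤ : x ∷ xs ≤ₗₑₓ y ∷ ys → x ≤ᴿ y
    head≤ (this (x≤y , _)) = x≤y
    head≤ (next x≈y _)     = O.reflexive x≈y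

    c≤y : c ≤ᴿ y
    c≤y = O.≤-respˡ-≈ x≈c (head≤ xs≤ys)

  -- Maximality of `f` enters the proof only through this bound.
  constantContrast≤ : ∀ {Vc} {g : Colouring Vc} {f} → IsMaximumContrast G Vc g f →
                      ∀ h → IsGreyscale h → Compatible Vc g h →
                      ∀ {c} → (∀ {u v} → Adj u v → dist (h u) (h v) ≈ c) →
                      ∀ {u v} → Adj u v → c ≤ᴿ dist (f u) (f v)
  constantContrast≤ {f = f} max h grey compat const-c =
    contrastVector-All⁻ f O.≤-respʳ-≈
      (constant≤ₗₑₓsorted (length-contrastVector h f) (contrastVector-All⁺ h const-c)
        (sort-↗ (contrasts f)) (IsMaximumContrast.maximal max h grey compat))

-- Maximum contrast greyscales of a complete bipartite graph.

module MaximumContrast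
  (ℝ : RealNumbers) {n : ℕ} {G : Graph n} (B : CompleteBipartition G)
  {Vc : Subset n} {g : Colouring Vc} (proper : NoMonochromaticEdge G Vc g)
  {f : Fin n → RealNumbers.Carrier ℝ}
  (max : Greyscales.IsMaximumContrast ℝ G Vc g f)
  where
  open RealNumbers ℝ renaming (_≤_ to infix 4 _≤ᴿ_)
  open Greyscales ℝ
  open Graph G
  open CompleteBipartition B
  open Distance ℝ
  open Contrast ℝ G
  open IsMaximumContrast max
  open IsGreyscale isGreyscale
  private
    module O = DecTotalOrder decTotalOrder

  dist-f≤1 : ∀ u v → dist (f u) (f v) ≤ᴿ 1#
  dist-f≤1 u v = dist≤1 (0≤f u) (f≤1 u) (0≤f v) (f≤1 v)

  f-bit : ∀ {v} → v ∈ Vc → ∃ λ b → f v ≈ bit b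
  f-bit {v} v∈ with g v v∈ | compatible v v∈
  ... | zero     | fv≈0 = false , fv≈0
  ... | suc zero | fv≈1 = true , fv≈1

  -- Compatibility transfers properness from `g` to the values of `f`, because 0 and 1 are distinct
  -- reals.
  sameValue⇒¬adj : ∀ {u v b} → u ∈ Vc → v ∈ Vc → f u ≈ bit b → f v ≈ bit b → ¬ Adj u v
  sameValue⇒¬adj {u} {v} u∈ v∈ fu≈b fv≈b uv =
    proper u v u∈ v∈ uv (⟦⟧-injective _ _
      (≈-trans (≈-sym (compatible u u∈)) (≈-trans fu≈b (≈-trans (≈-sym fv≈b) (compatible v v∈)))))
    where
    ⟦⟧-injective : ∀ i j → ⟦ i ⟧ ≈ ⟦ j ⟧ → i ≡ j
    ⟦⟧-injective zero       zero       _ = refl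
    ⟦⟧-injective (suc zero) (suc zero) _ = refl
    ⟦⟧-injective zero       (suc zero) p = contradiction p 0≉1
    ⟦⟧-injective (suc zero) zero       p = contradiction (≈-sym p) 0≉1

  -- The proper 2-colourings are `side` and its complement; `b` selects one. Since `f` agrees with
  -- `g` on `Vc`, this says that the chosen colouring extends `g`.
  Extends : Bool → Set
  Extends b = ∀ v → v ∈ Vc → f v ≈ bit (b xor side v)

  -- The 2-colouring itself is the competitor, with contrast 1 on every edge; 1 is also the largest
  -- distance in the unit interval.
  extends⇒ones : ∀ b → Extends b → All (_≈ 1#) (contrastVector G f)
  extends⇒ones b ext = contrastVector-All⁺ f λ {u} {v} uv →
    O.antisym (dist-f≤1 u v)
      (constantContrast≤ max h greyscale compatible′
        (λ xy → dist-bit-≢ (xor-≢ b (adj⇒≢ xy))) uv)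
    where
    h : Fin n → Carrier
    h v = bit (b xor side v)

    xor-≢ : ∀ b {x y} → x ≢ y → b xor x ≢ b xor y
    xor-≢ false x≢y = x≢y
    xor-≢ true  x≢y = x≢y ∘ Bool.not-injective

    -- The value `c` is taken on the side `b xor c`. Both sides being inhabited makes `h` reach 0
    -- and 1.
    attained : ∀ c → ∃ λ v → h v ≈ bit c
    attained c with v , eq ← inhabited (b xor c) =
      v , reflexive (cong bit (trans (cong (b xor_) eq) (xor-xor b)))
      where
      xor-xor : ∀ b → b xor (b xor c) ≡ c
      xor-xor false = refl
      xor-xor true  = Bool.not-involutive c

    greyscale : IsGreyscale h
    greyscale = record
      { 0≤f = λ _ → 0≤bit _
      ; f≤1 = λ _ → bit≤1 _
      ; 0∈f = attained false
      ; 1∈f = attained true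
      }

    compatible′ : Compatible Vc g h
    compatible′ v v∈ = ≈-trans (≈-sym (ext v v∈)) (compatible v v∈)

  -- Both values on one side: contrast one half.

  record Clash : Set where
    field
      {p q} : Fin n
      p∈    : p ∈ Vc
      q∈    : q ∈ Vc
      sides : side p ≡ side q
      fp≈0  : f p ≈ 0#
      fq≈1  : f q ≈ 1#

  module _ (clash : Clash) where
    open Clash clash

    Near : Fin n → Set
    Near v = side v ≡ side p

    near? : ∀ v → Dec (Near v)
    near? v = side v Bool.≟ side p

    far⇒adj-p : ∀ {v} → ¬ Near v → Adj v p
    far⇒adj-p = ≢⇒adj

    far⇒adj-q : ∀ {v} → ¬ Near v → Adj v q
    far⇒adj-q far = ≢⇒adj (λ eq → far (trans eq (sym sides)))

    -- A vertex of `Vc` on the far side would be adjacent to both `p` and `q`, so properness would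
    -- forbid it both values 0 and 1.
    Vc-near : ∀ {v} → v ∈ Vc → Near v
    Vc-near {v} v∈ with f-bit v∈
    ... | false , fv≈0 = decidable-stable (near? v)
      (sameValue⇒¬adj {b = false} v∈ p∈ fv≈0 fp≈0 ∘ far⇒adj-p)
    ... | true  , fv≈1 = decidable-stable (near? v)
      (sameValue⇒¬adj {b = true} v∈ q∈ fv≈1 fq≈1 ∘ far⇒adj-q)

    endpoint-far : ∀ {u v} → Adj u v → ¬ Near u ⊎ ¬ Near v
    endpoint-far {u} {v} uv with near? u
    ... | yes u-near = inj₂ λ v-near → adj⇒≢ uv (trans u-near (sym v-near))
    ... | no  u-far  = inj₁ u-far

    -- The competitor must be 0 or 1 on the whole near side and agree with `f` on `Vc`. Rounding `f`
    -- achieves both, since `f` is already 0 or 1 on `Vc`.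
    round : Carrier → Bool
    round x = does (1# O.≤? x)

    round-bit : ∀ {x} b → x ≈ bit b → bit (round x) ≈ bit b
    round-bit {x} b x≈b with 1# O.≤? x | b
    ... | yes _   | true  = ≈-refl
    ... | no _    | false = ≈-refl
    ... | yes 1≤x | false = O.antisym (O.≤-respʳ-≈ x≈b 1≤x) 0≤1
    ... | no 1≰x  | true  = contradiction (O.reflexive (≈-sym x≈b)) 1≰x

    h : Fin n → Carrier
    h v = if does (near? v) then bit (round (f v)) else ½

    h-near : ∀ {v} → Near v → h v ≈ bit (round (f v))
    h-near {v} v-near with near? v
    ... | yes _   = ≈-refl
    ... | no  far = contradiction v-near far

    h-Vc : ∀ {v} → v ∈ Vc → h v ≈ f v
    h-Vc v∈ with b , fv≈b ← f-bit v∈ =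
      ≈-trans (h-near (Vc-near v∈)) (≈-trans (round-bit b fv≈b) (≈-sym fv≈b))

    h-greyscale : IsGreyscale h
    h-greyscale = record
      { 0≤f = 0≤h
      ; f≤1 = h≤1
      ; 0∈f = p , ≈-trans (h-Vc p∈) fp≈0
      ; 1∈f = q , ≈-trans (h-Vc q∈) fq≈1
      }
      where
      0≤h : ∀ v → 0# ≤ᴿ h v
      0≤h v with near? v
      ... | yes _ = 0≤bit _
      ... | no  _ = 0≤½

      h≤1 : ∀ v → h v ≤ᴿ 1#
      h≤1 v with near? v
      ... | yes _ = bit≤1 _
      ... | no  _ = ½≤1

    h-contrast : ∀ {u v} → Adj u v → dist (h u) (h v) ≈ ½
    h-contrast {u} {v} uv with near? u | near? v
    ... | yes u-near | yes v-near = contradiction (trans u-near (sym v-near)) (adj⇒≢ uv)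
    ... | yes _      | no  _      = dist-bit-½ (round (f u))
    ... | no  _      | yes _      = ≈-trans (dist-sym _ _) (dist-bit-½ (round (f v)))
    -- With only two sides, both endpoints would lie on the complement of `side p`.
    ... | no  u-far  | no  v-far  =
      contradiction (trans (Bool.¬-not u-far) (sym (Bool.¬-not v-far))) (adj⇒≢ uv)

    ½≤contrast : ∀ {u v} → Adj u v → ½ ≤ᴿ dist (f u) (f v)
    ½≤contrast = constantContrast≤ max h h-greyscale
      (λ v v∈ → ≈-trans (h-Vc v∈) (compatible v v∈)) h-contrast

    -- A far vertex is adjacent to `p` and `q`, so the edge bound keeps its value at distance at
    -- least ½ from both 0 and 1.
    f-far : ∀ {v} → ¬ Near v → f v ≈ ½
    f-far {v} v-far = farFromEnds⇒≈½ (0≤f v) (f≤1 v)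
      (O.≤-respʳ-≈ (dist-cong ≈-refl fp≈0) (½≤contrast (far⇒adj-p v-far)))
      (O.≤-respʳ-≈ (dist-cong ≈-refl fq≈1) (½≤contrast (far⇒adj-q v-far)))

    -- Every edge has a far endpoint, where `f` is ½, and no point of the unit interval is farther
    -- than ½ from there.
    clash⇒halves : All (_≈ ½) (contrastVector G f)
    clash⇒halves = contrastVector-All⁺ f λ uv → O.antisym (contrast≤½ uv) (½≤contrast uv)
      where
      far-contrast≤½ : ∀ {u v} → ¬ Near v → dist (f u) (f v) ≤ᴿ ½
      far-contrast≤½ {u} v-far = O.≤-respˡ-≈ (dist-cong ≈-refl (≈-sym (f-far v-far)))
        (dist-½≤½ (0≤f u) (f≤1 u))

      contrast≤½ : ∀ {u v} → Adj u v → dist (f u) (f v) ≤ᴿ ½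
      contrast≤½ uv with endpoint-far uv
      ... | inj₁ u-far = O.≤-respˡ-≈ (dist-sym _ _) (far-contrast≤½ u-far)
      ... | inj₂ v-far = far-contrast≤½ v-far

  -- The dichotomy between the two cases.

  ¬extends⇒violation : ∀ b → ¬ Extends b → ∃ λ v → v ∈ Vc × f v ≈ bit (not b xor side v)
  ¬extends⇒violation b ¬ext = v , v∈ , ≈-trans fv≈c (reflexive (cong bit c≡))
    where
    Agrees : Fin n → Set
    Agrees v = v ∈ Vc → f v ≈ bit (b xor side v)

    violation = ¬∀⟶∃¬ n Agrees (λ v → (v ∈? Vc) →-dec (f v O.≟ _)) ¬ext
    v = proj₁ violation

    v∈ : v ∈ Vc
    v∈ = decidable-stable (v ∈? Vc) λ v∉ → proj₂ violation λ v∈ → contradiction v∈ v∉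

    c = proj₁ (f-bit v∈)
    fv≈c = proj₂ (f-bit v∈)

    c≡ : c ≡ not b xor side v
    c≡ = trans (Bool.¬-not λ eq → proj₂ violation λ _ → ≈-trans fv≈c (reflexive (cong bit eq)))
               (Bool.not-distribˡ-xor b (side v))

  -- The violations say that `f` is the complement of the side at `u` and the side itself at `w`. On
  -- opposite sides these values would coincide across an edge, against properness; hence the sides
  -- agree and the values differ.
  violations⇒clash : ¬ Extends false → ¬ Extends true → Clash
  violations⇒clash ¬ext₀ ¬ext₁
    with u , u∈ , fu ← ¬extends⇒violation false ¬ext₀
       | w , w∈ , fw ← ¬extends⇒violation true ¬ext₁ = order (side u) refl
    where
    sides : side u ≡ side w
    sides = decidable-stable (side u Bool.≟ side w) λ u≢w →
      sameValue⇒¬adj u∈ w∈ (≈-trans fu (reflexive (cong bit (sym (Bool.¬-not (u≢w ∘ sym)))))) fw (≢⇒adj u≢w)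

    -- The value at `u` is 0 precisely when its side is `true`, so the side decides which vertex
    -- serves as `p`.
    order : ∀ b → side u ≡ b → Clash
    order true  eq = record
      { p∈ = u∈ ; q∈ = w∈ ; sides = sides
      ; fp≈0 = ≈-trans fu (reflexive (cong (bit ∘ not) eq))
      ; fq≈1 = ≈-trans fw (reflexive (cong bit (trans (sym sides) eq)))
      }
    order false eq = record
      { p∈ = w∈ ; q∈ = u∈ ; sides = sym sides
      ; fp≈0 = ≈-trans fw (reflexive (cong bit (trans (sym sides) eq)))
      ; fq≈1 = ≈-trans fu (reflexive (cong (bit ∘ not) eq))
      }

  extends? : ∀ b → Dec (Extends b)
  extends? b = all? λ v → (v ∈? Vc) →-dec (f v O.≟ _)

  ones⊎halves : All (_≈ 1#) (contrastVector G f) ⊎ All (_≈ ½) (contrastVector G f)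
  ones⊎halves with extends? false | extends? true
  ... | yes ext   | _         = inj₁ (extends⇒ones false ext)
  ... | no  _     | yes ext   = inj₁ (extends⇒ones true ext)
  ... | no  ¬ext₀ | no  ¬ext₁ = inj₂ (clash⇒halves (violations⇒clash ¬ext₀ ¬ext₁))

theorem5p4 : (ℝ : RealNumbers) →
    let module R = RealNumbers ℝ
        open Greyscales ℝ in
    (r s : ℕ) → 1 ≤ r → 1 ≤ s →
    (n : ℕ) (G : Graph n) → G ≅ K r s →
    (Vc : Subset n) → Nonempty Vc → Vc ⊂ ⊤ →
    (g : Colouring Vc) → NoMonochromaticEdge G Vc g →
    (f : Fin n → R.Carrier) → IsMaximumContrast G Vc g f →
    All (λ c → c R.≈ R.1#) (contrastVector G f) ⊎ All (λ c → c R.≈ R.½) (contrastVector G f)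
theorem5p4 ℝ r s 1≤r 1≤s n G G≅K Vc _ _ g proper f max =
  MaximumContrast.ones⊎halves ℝ (completeBipartition 1≤r 1≤s G≅K) proper max
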